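{- Let $\alpha=(\alpha_1,\dots,\alpha_t)$ be palindromic (i.e. $\alpha_i=\alpha_{t+1-i}$ for all $i$) with $t$ odd, let $F=\breve F(\alpha)$ with elements $x_1,\dots,x_n$ and shared elements $s_1,\dots,s_{t-1}$. Assume that $\chi_{s_i}-\chi_{s_{t-i}}$ is $0$-mesic under rowmotion for all $i\in[t-1]$. Then (1) $\chi_{x_k}-\chi_{x_{n-k+1}}$ is $0$-mesic for all $k\in[n]$, and (2) $\hat\chi_{x_k}+\hat\chi_{x_{n-k+1}}$ is $1$-mesic for all $k\in[n]$.
   Context: A fence $\breve F(\alpha_1,\dots,\alpha_t)$ ($t\ge2$, positive integers, $\alpha_1,\alpha_t\ge2$) is the poset on $\{x_1,\dots,x_n\}$, $n=\alpha_1+\dots+\alpha_t-1$, with $a_i=\alpha_1+\dots+\alpha_i$, $a_0=0$, whose cover relations are: for $1\le j\le n-1$ with $a_{i-1}\le j<a_i$, $x_j\lessdot x_{j+1}$ if $i$ odd and $x_j\gtrdot x_{j+1}$ if $i$ even. Shared elements: $s_i=x_{a_i}$. $\mathcal J(F)$ is the set of order ideals; rowmotion $\rho:\mathcal J(F)\to\mathcal J(F)$ sends $I$ to the order ideal generated by $\min(F\setminus I)$. $\hat\chi_q(I)=1$ if $q\in I$, else 0; $\chi_q(I)=1$ if $q\in\max(I)$, else 0. A statistic $f:\mathcal J(F)\to\mathbb R$ is $c$-mesic under rowmotion if its average over every $\rho$-orbit equals $c$. -}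

module Defs where

open import Data.Bool.Base using (if_then_else_)
open import Data.Fin.Base using (Fin; zero; suc; toℕ; fromℕ<; opposite)
open import Data.Fin.Properties using (all?; any?; _≟_; toℕ<n)
open import Data.Fin.Subset using (Subset; _∈_; ∁)
open import Data.Fin.Subset.Properties using (_∈?_)
open import Data.Integer.Base using (1ℤ)
open import Data.List.Base using (List; _∷_; length; lookup; take; map; foldr)
open import Data.List.Membership.Propositional using () renaming (_∈_ to _∈ˡ_)
open import Data.List.NonEmpty.Base as List⁺ using (List⁺; toList)
open import Data.List.Relation.Unary.All using (All; _∷_)
open import Data.List.Relation.Unary.Unique.Propositional using (Unique)
open import Data.Nat.Base as ℕ using (ℕ; zero; suc; _∸_; _≤_; _<_; s≤s)
import Data.Nat.Properties as ℕ
open import Data.Nat.Divisibility using (_∣_; _∤_; _∣?_)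
open import Data.Nat.GeneralisedArithmetic using (iterate)
open import Data.Nat.ListAction using (sum)
open import Data.Product.Base using (∃; _×_; _,_)
open import Data.Rational.Base using (ℚ; 0ℚ; 1ℚ; _/_; _+_; _*_)
open import Data.Sum.Base using (_⊎_; inj₁; inj₂)
open import Data.Vec.Base using (tabulate)
open import Data.Vec.Properties using (lookup∘tabulate; lookup⇒[]=; []=⇒lookup)
open import Function.Base using (_∘_)
open import Function.Bundles using (_⇔_)
open import Level using (0ℓ)
open import Relation.Binary.Construct.Closure.ReflexiveTransitive using (Star; ε; _◅_; _◅◅_)
open import Relation.Binary.Core using (Rel)
open import Relation.Binary.Definitions using (Transitive) renaming (Decidable to Decidable₂)
open import Relation.Binary.PropositionalEquality using (_≡_; refl; sym; trans)
open import Relation.Nullary.Decidable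
  using (Dec; yes; no; does; map′; dec-true; ¬?; _×-dec_; _⊎-dec_; _→-dec_)
open import Relation.Unary using (Pred; Decidable)

-- One vertex is eliminated at a time: Bypass R i j relates i to j directly
-- or by way of vertex zero.

Bypass : ∀ {n} → Rel (Fin (suc n)) 0ℓ → Rel (Fin n) 0ℓ
Bypass R i j = R (suc i) (suc j) ⊎ (R (suc i) zero × R zero (suc j))

private
  module _ {n} {R : Rel (Fin (suc n)) 0ℓ} where

    lift : ∀ {i j} → Star (Bypass R) i j → Star R (suc i) (suc j)
    lift ε                    = ε
    lift (inj₁ r       ◅ rs) = r ◅ lift rs
    lift (inj₂ (r , s) ◅ rs) = r ◅ s ◅ lift rs

    lower   : ∀ {i j} → Star R (suc i) (suc j) → Star (Bypass R) i j
    lowerVia : ∀ {i j} → R (suc i) zero → Star R zero (suc j) → Star (Bypass R) i j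
    lower ε                       = ε
    lower (_◅_ {j = zero}  r rs) = lowerVia r rs
    lower (_◅_ {j = suc _} r rs) = inj₁ r ◅ lower rs
    lowerVia r (_◅_ {j = zero}  _ rs) = lowerVia r rs
    lowerVia r (_◅_ {j = suc _} s rs) = inj₂ (r , s) ◅ lower rs

    lowerFrom0 : ∀ {j} → Star R zero (suc j) → ∃ λ k → R zero (suc k) × Star (Bypass R) k j
    lowerFrom0 (_◅_ {j = zero}  _ rs) = lowerFrom0 rs
    lowerFrom0 (_◅_ {j = suc k} r rs) = k , r , lower rs

    lowerTo0 : ∀ {i} → Star R (suc i) zero → ∃ λ k → Star (Bypass R) i k × R (suc k) zero
    lowerTo0 {i} (_◅_ {j = zero}  r rs) = i , ε , r
    lowerTo0     (_◅_ {j = suc _} r rs) with lowerTo0 rs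
    ... | k , ss , s = k , inj₁ r ◅ ss , s

star? : ∀ {n} {R : Rel (Fin n) 0ℓ} → Decidable₂ R → Decidable₂ (Star R)
star? {suc n} {R} R? = go
  where
  bypass? : Decidable₂ (Star (Bypass R))
  bypass? = star? λ i j → R? (suc i) (suc j) ⊎-dec (R? (suc i) zero ×-dec R? zero (suc j))

  go : Decidable₂ (Star R)
  go zero    zero    = yes ε
  go zero    (suc j) = map′ (λ (_ , r , rs) → r ◅ lift rs) lowerFrom0
                            (any? λ k → R? zero (suc k) ×-dec bypass? k j)
  go (suc i) zero    = map′ (λ (_ , rs , r) → lift rs ◅◅ r ◅ ε) lowerTo0
                            (any? λ k → bypass? i k ×-dec R? (suc k) zero)
  go (suc i) (suc j) = map′ lift lower (bypass? i j)

module _ {n} {P : Pred (Fin n) 0ℓ} (P? : Decidable P) where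

  comprehension : Subset n
  comprehension = tabulate (does ∘ P?)

  ∈-comprehension⁺ : ∀ {x} → P x → x ∈ comprehension
  ∈-comprehension⁺ {x} px =
    lookup⇒[]= x _ (trans (lookup∘tabulate (does ∘ P?) x) (dec-true (P? x) px))

  ∈-comprehension⁻ : ∀ {x} → x ∈ comprehension → P x
  ∈-comprehension⁻ {x} x∈ with P? x | trans (sym (lookup∘tabulate (does ∘ P?) x)) ([]=⇒lookup x∈)
  ... | yes px | _  = px
  ... | no _   | ()

indicator : ∀ {n} → Subset n → Fin n → ℚ
indicator S q = if does (q ∈? S) then 1ℚ else 0ℚ

module Rowmotion {n} {_⊑_ : Rel (Fin n) 0ℓ}
                 (⊑-trans : Transitive _⊑_) (_⊑?_ : Decidable₂ _⊑_) where

  IsLowerSet : Subset n → Set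
  IsLowerSet S = ∀ {x y} → x ⊑ y → y ∈ S → x ∈ S

  -- Irrelevance of the second field makes propositional equality of ideals
  -- coincide with equality of the underlying subsets.
  record OrderIdeal : Set where
    constructor mkIdeal
    field
      elements    : Subset n
      .isLowerSet : IsLowerSet elements

  open OrderIdeal public using (elements)

  IsMinimal IsMaximal : Subset n → Fin n → Set
  IsMinimal S m = m ∈ S × (∀ y → y ∈ S → y ⊑ m → y ≡ m)
  IsMaximal S m = m ∈ S × (∀ y → y ∈ S → m ⊑ y → y ≡ m)

  isMinimal? : ∀ S → Decidable (IsMinimal S)
  isMinimal? S m = m ∈? S ×-dec all? λ y → y ∈? S →-dec (y ⊑? m →-dec y ≟ m)

  isMaximal? : ∀ S → Decidable (IsMaximal S)
  isMaximal? S m = m ∈? S ×-dec all? λ y → y ∈? S →-dec (m ⊑? y →-dec y ≟ m)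

  minima maxima : Subset n → Subset n
  minima S = comprehension (isMinimal? S)
  maxima S = comprehension (isMaximal? S)

  IsBelow : Subset n → Fin n → Set
  IsBelow A x = ∃ λ m → m ∈ A × x ⊑ m

  isBelow? : ∀ A → Decidable (IsBelow A)
  isBelow? A x = any? λ m → m ∈? A ×-dec x ⊑? m

  idealGeneratedBy : Subset n → OrderIdeal
  idealGeneratedBy A = mkIdeal (comprehension (isBelow? A)) λ x⊑y y∈ →
    let m , m∈A , y⊑m = ∈-comprehension⁻ (isBelow? A) y∈
    in  ∈-comprehension⁺ (isBelow? A) (m , m∈A , ⊑-trans x⊑y y⊑m)

  ρ : OrderIdeal → OrderIdeal
  ρ I = idealGeneratedBy (minima (∁ (elements I)))

  χ̂ χ : Fin n → OrderIdeal → ℚ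
  χ̂ q I = indicator (elements I) q
  χ q I = indicator (maxima (elements I)) q

  -- O lists, without repetition, a ρ-orbit.  As there are finitely many
  -- ideals and ρ is invertible, nonnegative powers of ρ suffice.
  IsOrbit : List⁺ OrderIdeal → Set
  IsOrbit O = Unique (toList O) ×
              ∃ λ I → ∀ J → J ∈ˡ toList O ⇔ (∃ λ k → J ≡ iterate ρ I k)

  average : (OrderIdeal → ℚ) → List⁺ OrderIdeal → ℚ
  average f O = foldr _+_ 0ℚ (map f (toList O)) * (1ℤ / List⁺.length O)

  _IsMesic_ : ℚ → (OrderIdeal → ℚ) → Set
  c IsMesic f = ∀ O → IsOrbit O → average f O ≡ c

record FenceComposition : Set where
  field
    parts    : List ℕ
    t≥2      : 2 ≤ length parts
    positive : All (1 ≤_) parts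
    first≥2  : ∀ i → toℕ i ≡ 0 → 2 ≤ lookup parts i
    last≥2   : ∀ i → suc (toℕ i) ≡ length parts → 2 ≤ lookup parts i

private
  sum-take-< : ∀ {xs k} → All (1 ≤_) xs → k < length xs → sum (take k xs) < sum xs
  sum-take-< {x ∷ xs} {zero}  (p ∷ _)  _         = ℕ.≤-trans p (ℕ.m≤m+n x (sum xs))
  sum-take-< {x ∷ xs} {suc k} (_ ∷ ps) (s≤s k<l) = ℕ.+-monoʳ-< x (sum-take-< ps k<l)

  sum-take-≥1 : ∀ {xs k} → All (1 ≤_) xs → suc k ≤ length xs → 1 ≤ sum (take (suc k) xs)
  sum-take-≥1 {x ∷ xs} (p ∷ _) _ = ℕ.≤-trans p (ℕ.m≤m+n x _)

module Fence (α : FenceComposition) where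
  open FenceComposition α public

  t : ℕ
  t = length parts

  a : ℕ → ℕ
  a i = sum (take i parts)

  n : ℕ
  n = sum parts ∸ 1

  -- The ground set x₁, …, xₙ is Fin n, with k : Fin n standing for the
  -- element x with subscript index k; so opposite k stands for the element
  -- with subscript n - index k + 1.
  index : Fin n → ℕ
  index k = suc (toℕ k)

  -- Zero-based i : Fin t stands for the (i+1)-st segment.
  InSegment : Fin t → ℕ → Set
  InSegment i j = a (toℕ i) ≤ j × j < a (suc (toℕ i))

  infix 4 _⋖_ _⊑_ _⊑?_

  _⋖_ : Rel (Fin n) 0ℓ
  x ⋖ y = (index y ≡ suc (index x) × ∃ λ i → 2 ∤ suc (toℕ i) × InSegment i (index x))
        ⊎ (index x ≡ suc (index y) × ∃ λ i → 2 ∣ suc (toℕ i) × InSegment i (index y))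

  _⊑_ : Rel (Fin n) 0ℓ
  _⊑_ = Star _⋖_

  inSegment? : ∀ i j → Dec (InSegment i j)
  inSegment? i j = a (toℕ i) ℕ.≤? j ×-dec j ℕ.<? a (suc (toℕ i))

  _⋖?_ : Decidable₂ _⋖_
  x ⋖? y =
    (index y ℕ.≟ suc (index x) ×-dec any? λ i → ¬? (2 ∣? suc (toℕ i)) ×-dec inSegment? i (index x))
    ⊎-dec
    (index x ℕ.≟ suc (index y) ×-dec any? λ i → 2 ∣? suc (toℕ i) ×-dec inSegment? i (index y))

  _⊑?_ : Decidable₂ _⊑_
  _⊑?_ = star? _⋖?_

  open Rowmotion _◅◅_ _⊑?_ public

  -- Zero-based i : Fin (t ∸ 1) stands for the shared element with subscript
  -- i+1; so opposite i stands for the one with subscript t - (i+1).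
  s : Fin (t ∸ 1) → Fin n
  s i = fromℕ< {a (suc (toℕ i)) ∸ 1} (ℕ.∸-monoˡ-< (sum-take-< positive i+1<t)
                                         (sum-take-≥1 positive (ℕ.<⇒≤ i+1<t)))
    where
    i+1<t : suc (toℕ i) < t
    i+1<t = ℕ.≤-trans (s≤s (toℕ<n i)) (ℕ.≤-reflexive (ℕ.m+[n∸m]≡n (ℕ.<⇒≤ t≥2)))

  Palindromic : Set
  Palindromic = ∀ i → lookup parts i ≡ lookup parts (opposite i)

{-# OPTIONS --safe #-}
module Submission where

-- Extend the fence by x₀, lying in every ideal, and x_{n+1}, lying in none, and
-- let h j be the number of ideals of an orbit containing x_j and r j the number
-- of those having x_j as a maximal element.  An element is maximal in ρ I
-- exactly when it is minimal outside I, so r can be counted from either side.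
-- If x_j is not shared, comparing both counts shows that
-- h (j-1) + h (j+1) = 2 h j; at a peak r j = h j - h (n+1), at a valley
-- r j = h 0 - h j.  The reflection j ↦ n+1-j exchanges peaks and valleys, so by
-- hypothesis g j = h j + h (n+1-j) equals h 0 + h (n+1) at the shared elements.
-- As g is harmonic elsewhere, it is constant by the maximum principle.  This is
-- claim (2), and claim (1) follows since r is a difference of values of h.

open import Defs
open import Algebra.Bundles using (CommutativeMonoid)
import Algebra.Properties.CommutativeSemigroup as CommutativeSemigroupProperties
import Algebra.Properties.Group as GroupProperties
open import Data.Bool.Base using (if_then_else_)
open import Data.Fin.Base using (Fin; zero; suc; toℕ; fromℕ<; opposite)
open import Data.Fin.Induction using (po-wellFounded)
open import Data.Fin.Properties
  using (any?; _≟_; toℕ<n; toℕ-fromℕ<; toℕ-injective; opposite-prop; opposite-involutive)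
open import Data.Fin.Subset using (∁) renaming (_∈_ to _∈ˢ_; _⊆_ to _⊆ˢ_)
open import Data.Fin.Subset.Properties
  using (x∈∁p⇒x∉p; x∉p⇒x∈∁p; ⊆-antisym) renaming (_∈?_ to _∈ˢ?_)
open import Data.Integer.Base as ℤ using (ℤ; 0ℤ; 1ℤ)
import Data.Integer.Properties as ℤ
open import Data.List.Base using (List; []; _∷_; [_]; _++_; foldr; length; lookup; map; take)
open import Data.List.Membership.Propositional.Properties using (∈-∃++; ∈-map⁻)
open import Data.List.NonEmpty.Base as List⁺ using (toList)
open import Data.List.Properties using (length-map; map-∘; take-all; take-suc)
open import Data.List.Relation.Binary.Permutation.Propositional
  using (_↭_; refl; prep; ↭-trans; ↭-sym; ↭⇒↭ₛ)
open import Data.List.Relation.Binary.Permutation.Propositional.Properties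
  using (∈-resp-↭; map⁺; shift; ↭-length)
import Data.List.Relation.Binary.Permutation.Setoid.Properties as ↭ₛ
open import Data.List.Relation.Binary.Subset.Propositional using (_⊆_)
open import Data.List.Relation.Unary.All using (All; _∷_)
open import Data.List.Relation.Unary.AllPairs using (_∷_)
open import Data.List.Relation.Unary.Any using (here; there)
open import Data.List.Relation.Unary.Unique.Propositional using (Unique)
import Data.List.Relation.Unary.Unique.Propositional.Properties as Unique
open import Data.Nat.Base as ℕ using (ℕ; zero; suc; _∸_; s≤s; z≤n)
open import Data.Nat.Divisibility
  using (_∣_; _∤_; _∣?_; _∣0; divides; ∣-refl; ∣m+n∣m⇒∣n; ∣m∣n⇒∣m+n)
open import Data.Nat.GeneralisedArithmetic using (iterate)
open import Data.Nat.ListAction using (sum)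
open import Data.Nat.ListAction.Properties using (sum-++)
import Data.Nat.Properties as ℕ
open import Data.Product.Base using (∃; _×_; _,_)
open import Data.Rational.Base
  using (ℚ; 0ℚ; 1ℚ; _/_; _+_; _*_; -_; _-_; _≤_; _<_; toℚᵘ)
import Data.Rational.Properties as ℚ
open import Data.Rational.Solver using (module +-*-Solver)
import Data.Rational.Unnormalised.Base as ℚᵘ
import Data.Rational.Unnormalised.Properties as ℚᵘ
open import Data.Sum.Base using (_⊎_; inj₁; inj₂; [_,_]′)
open import Function.Base using (_∘_)
open import Function.Bundles using (_⇔_; mk⇔; Equivalence)
open import Function.Definitions using (Injective)
open import Induction.WellFounded using (Acc; acc)
open import Level using (0ℓ)
open import Relation.Binary.Construct.Closure.ReflexiveTransitive using (ε; _◅_; _◅◅_)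
import Relation.Binary.Construct.NonStrictToStrict as ToStrict
open import Relation.Binary.Core using (Rel)
open import Relation.Binary.Definitions
  using (Reflexive; Transitive; Antisymmetric) renaming (Decidable to Decidable₂)
open import Relation.Binary.PropositionalEquality hiding ([_])
open import Relation.Binary.Structures using (IsPartialOrder)
open import Relation.Nullary
  using (¬_; Dec; yes; no; contradiction; does; recompute; ¬?; _×-dec_; _⊎-dec_)
open import Relation.Nullary.Decidable using (decidable-stable; dec-false; does-⇔)

open CommutativeSemigroupProperties
  (CommutativeMonoid.commutativeSemigroup ℚ.+-0-commutativeMonoid) using (interchange)
open GroupProperties ℚ.+-0-group using (x∙y⁻¹≈ε⇒x≈y)
open +-*-Solver using (solve; _:+_; _:-_; _:=_)

-- Sums over lists and their invariance under permutation.

-- Pigeonhole principle: each element of `xs` is cut out of `ys` in turn, and since it does not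
-- recur in `xs`, the rest of `xs` stays inside what remains.
unique-⊆⇒↭ : ∀ {A : Set} {xs ys : List A} →
             Unique xs → xs ⊆ ys → length ys ≡ length xs → xs ↭ ys
unique-⊆⇒↭ {xs = []}     {[]}  _        _     _  = refl
unique-⊆⇒↭ {xs = x ∷ xs} {ys} (x≢ ∷ !xs) xs⊆ys eq with ∈-∃++ (xs⊆ys (here refl))
... | ys₁ , ys₂ , refl = ↭-trans (prep x (unique-⊆⇒↭ !xs xs⊆ys′ len)) (↭-sym ys↭)
  where
  ys↭ : ys₁ ++ [ x ] ++ ys₂ ↭ x ∷ ys₁ ++ ys₂
  ys↭ = shift x ys₁ ys₂

  xs⊆ys′ : xs ⊆ ys₁ ++ ys₂
  xs⊆ys′ v∈xs with ∈-resp-↭ ys↭ (xs⊆ys (there v∈xs))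
  ... | here refl = contradiction v∈xs (Unique.Unique[x∷xs]⇒x∉xs (x≢ ∷ !xs))
  ... | there v∈  = v∈

  len : length (ys₁ ++ ys₂) ≡ length xs
  len = ℕ.suc-injective (trans (sym (↭-length ys↭)) eq)

module _ {A : Set} where

  sumOver : List A → (A → ℚ) → ℚ
  sumOver xs f = foldr _+_ 0ℚ (map f xs)

  sumOver-cong : ∀ xs {f g : A → ℚ} → (∀ x → f x ≡ g x) → sumOver xs f ≡ sumOver xs g
  sumOver-cong []       f≗g = refl
  sumOver-cong (x ∷ xs) f≗g = cong₂ _+_ (f≗g x) (sumOver-cong xs f≗g)

  sumOver-+ : ∀ xs (f g : A → ℚ) →
              sumOver xs (λ x → f x + g x) ≡ sumOver xs f + sumOver xs g
  sumOver-+ []       f g = refl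
  sumOver-+ (x ∷ xs) f g = begin
    (f x + g x) + sumOver xs (λ x → f x + g x)       ≡⟨ cong ((f x + g x) +_) (sumOver-+ xs f g) ⟩
    (f x + g x) + (sumOver xs f + sumOver xs g)      ≡⟨ interchange (f x) (g x) _ _ ⟩
    (f x + sumOver xs f) + (g x + sumOver xs g)      ∎
    where open ≡-Reasoning

  sumOver-neg : ∀ xs (f : A → ℚ) → sumOver xs (λ x → - f x) ≡ - sumOver xs f
  sumOver-neg []       f = refl
  sumOver-neg (x ∷ xs) f =
    trans (cong (- f x +_) (sumOver-neg xs f)) (sym (ℚ.neg-distrib-+ (f x) _))

  sumOver-- : ∀ xs (f g : A → ℚ) →
              sumOver xs (λ x → f x - g x) ≡ sumOver xs f - sumOver xs g
  sumOver-- xs f g =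
    trans (sumOver-+ xs f (λ x → - g x)) (cong (sumOver xs f +_) (sumOver-neg xs g))

  sumOver-↭ : ∀ {xs ys} (f : A → ℚ) → xs ↭ ys → sumOver xs f ≡ sumOver ys f
  sumOver-↭ {xs} {ys} f xs↭ys = ↭ₛ.foldr-commMonoid (setoid ℚ) ℚ.+-0-isCommutativeMonoid
    (↭⇒↭ₛ (map⁺ f xs↭ys))

  -- Injectivity keeps the images distinct, so `h` merely rearranges the list.
  sumOver-permute : ∀ {xs} (h : A → A) → Injective _≡_ _≡_ h → Unique xs → map h xs ⊆ xs →
                    ∀ f → sumOver xs (f ∘ h) ≡ sumOver xs f
  sumOver-permute {xs} h h-inj !xs hxs⊆xs f =
    trans (cong (foldr _+_ 0ℚ) (map-∘ xs))
          (sumOver-↭ f (unique-⊆⇒↭ (Unique.map⁺ h-inj !xs) hxs⊆xs (sym (length-map h xs))))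

  -- The step is checked on unnormalised fractions, since `_/_` reduces to lowest terms and does not
  -- compute on a variable numerator.
  sumOver-1 : ∀ xs → sumOver xs (λ _ → 1ℚ) ≡ ℤ.+ length xs / 1
  sumOver-1 []       = refl
  sumOver-1 (x ∷ xs) = ℚ.toℚᵘ-injective (begin
    toℚᵘ (1ℚ + sumOver xs (λ _ → 1ℚ))    ≡⟨ cong (λ q → toℚᵘ (1ℚ + q)) (sumOver-1 xs) ⟩
    toℚᵘ (1ℚ + ℤ.+ length xs / 1)          ≈⟨ ℚ.toℚᵘ-homo-+ 1ℚ (ℤ.+ length xs / 1) ⟩
    toℚᵘ 1ℚ ℚᵘ.+ toℚᵘ (ℤ.+ length xs / 1)  ≈⟨ ℚᵘ.+-congʳ (toℚᵘ 1ℚ) (ℚ.toℚᵘ-fromℚᵘ (ℚᵘ.mkℚᵘ k 0)) ⟩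
    toℚᵘ 1ℚ ℚᵘ.+ ℚᵘ.mkℚᵘ (ℤ.+ length xs) 0 ≈⟨ ℚᵘ.*≡* (cong (λ i → (1ℤ ℤ.+ i) ℤ.* 1ℤ) (ℤ.*-identityʳ k)) ⟩
    ℚᵘ.mkℚᵘ (ℤ.+ suc (length xs)) 0        ≈⟨ ℚ.toℚᵘ-fromℚᵘ (ℚᵘ.mkℚᵘ (ℤ.+ suc (length xs)) 0) ⟨
    toℚᵘ (ℤ.+ suc (length xs) / 1)         ∎)
    where
    open ℚᵘ.≃-Reasoning
    k : ℤ
    k = ℤ.+ length xs

  sumOver-1-inverse : ∀ x xs → sumOver (x ∷ xs) (λ _ → 1ℚ) * (1ℤ / suc (length xs)) ≡ 1ℚ
  sumOver-1-inverse x xs = ℚ.toℚᵘ-injective (begin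
    toℚᵘ (sumOver (x ∷ xs) (λ _ → 1ℚ) * (1ℤ / n))   ≡⟨ cong (λ s → toℚᵘ (s * (1ℤ / n))) (sumOver-1 (x ∷ xs)) ⟩
    toℚᵘ ((ℤ.+ n / 1) * (1ℤ / n))                   ≈⟨ ℚ.toℚᵘ-homo-* (ℤ.+ n / 1) (1ℤ / n) ⟩
    toℚᵘ (ℤ.+ n / 1) ℚᵘ.* toℚᵘ (1ℤ / n)             ≈⟨ ℚᵘ.*-cong (ℚ.toℚᵘ-fromℚᵘ (ℚᵘ.mkℚᵘ (ℤ.+ n) 0))
                                                                 (ℚ.toℚᵘ-fromℚᵘ (ℚᵘ.mkℚᵘ 1ℤ (length xs))) ⟩
    ℚᵘ.mkℚᵘ (ℤ.+ n) 0 ℚᵘ.* ℚᵘ.mkℚᵘ 1ℤ (length xs)   ≈⟨ ℚᵘ.*-inverseʳ (ℚᵘ.mkℚᵘ (ℤ.+ n) 0) ⟩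
    toℚᵘ 1ℚ                                         ∎)
    where
    open ℚᵘ.≃-Reasoning
    n : ℕ
    n = suc (length xs)

-- A discrete maximum principle.

private
  -- Once g is at least c and increases, it keeps increasing up to m.
  climb : ∀ {m} (g : ℕ → ℚ) (c : ℚ) → g m ≡ c →
          (∀ j → suc j ℕ.< m →
             g (suc j) ≡ c ⊎ g j + g (suc (suc j)) ≡ g (suc j) + g (suc j)) →
          ∀ k j → k ℕ.+ suc j ≡ m → c ≤ g j → ¬ g j < g (suc j)
  climb g c gm int zero    j refl c≤ inc = ℚ.<-irrefl (sym gm) (ℚ.≤-<-trans c≤ inc)
  climb g c gm int (suc k) j eq   c≤ inc
    with int j (ℕ.≤-trans (ℕ.m≤n+m _ k) (ℕ.≤-reflexive (trans (ℕ.+-suc k _) eq)))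
  ... | inj₁ gj≡c = ℚ.<-irrefl (sym gj≡c) (ℚ.≤-<-trans c≤ inc)
  ... | inj₂ avg  = climb g c gm int k (suc j) (trans (ℕ.+-suc k _) eq) (ℚ.<⇒≤ (ℚ.≤-<-trans c≤ inc))
    -- Were the next step not upward, the two neighbours would sum to less than twice the middle
    -- value.
    (ℚ.≰⇒> λ dec → ℚ.<-irrefl avg (ℚ.+-mono-<-≤ inc dec))

-- Induction from the left: if `g` first leaves `c` upwards, no later point can have value `c` and
-- harmonic points keep the direction, contrary to `g m ≡ c`. A fall of `g` is a rise of its
-- negative.
maximum-principle :
  ∀ {m} (g : ℕ → ℚ) (c : ℚ) → g 0 ≡ c → g m ≡ c →
  (∀ j → suc j ℕ.< m →
     g (suc j) ≡ c ⊎ g j + g (suc (suc j)) ≡ g (suc j) + g (suc j)) →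
  ∀ j → j ℕ.≤ m → g j ≡ c
maximum-principle g c g0 gm int zero    _     = g0
maximum-principle {m} g c g0 gm int (suc j) 1+j≤m = ℚ.≤-antisym
  (ℚ.≮⇒≥ λ inc → climb g c gm int k j eq (ℚ.≤-reflexive (sym gj≡c))
                   (subst (_< g (suc j)) (sym gj≡c) inc))
  (ℚ.≮⇒≥ λ dec → climb (-_ ∘ g) (- c) (cong -_ gm) negInt k j eq (ℚ.≤-reflexive (cong -_ (sym gj≡c)))
                   (ℚ.neg-antimono-< (subst (g (suc j) <_) (sym gj≡c) dec)))
  where
  k = m ℕ.∸ suc j
  eq : k ℕ.+ suc j ≡ m
  eq = ℕ.m∸n+n≡m 1+j≤m

  gj≡c : g j ≡ c
  gj≡c = maximum-principle g c g0 gm int j (ℕ.<⇒≤ 1+j≤m)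

  negInt : ∀ j → suc j ℕ.< m →
           - g (suc j) ≡ - c ⊎ - g j + - g (suc (suc j)) ≡ - g (suc j) + - g (suc j)
  negInt j lt with int j lt
  ... | inj₁ p = inj₁ (cong -_ p)
  ... | inj₂ p = inj₂ (trans (sym (ℚ.neg-distrib-+ (g j) _))
                             (trans (cong -_ p) (ℚ.neg-distrib-+ (g (suc j)) _)))

-- Indicators of decidable propositions.

𝟙 : ∀ {P : Set} → Dec P → ℚ
𝟙 P? = if does P? then 1ℚ else 0ℚ

𝟙-cong : ∀ {P Q : Set} {P? : Dec P} {Q? : Dec Q} → P ⇔ Q → 𝟙 P? ≡ 𝟙 Q?
𝟙-cong {P? = P?} {Q?} P⇔Q = cong (if_then 1ℚ else 0ℚ) (does-⇔ P⇔Q P? Q?)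

-- Serves to turn "`x` is in the ideal but its upper neighbour is not" into a linear relation
-- between membership counts.
𝟙-diff : ∀ {P Q R : Set} (P? : Dec P) (Q? : Dec Q) (R? : Dec R) →
         P ⇔ (Q × ¬ R) → (R → Q) → 𝟙 P? ≡ 𝟙 Q? - 𝟙 R?
𝟙-diff P? Q? R? P⇔ R⇒Q = trans (𝟙-cong {P? = P?} {Q? ×-dec ¬? R?} P⇔) (split Q? R?)
  where
  split : ∀ Q? R? → 𝟙 (Q? ×-dec ¬? R?) ≡ 𝟙 Q? - 𝟙 R?
  split (yes _) (yes _) = refl
  split (yes _) (no _)  = refl
  split (no ¬q) (yes r) = contradiction (R⇒Q r) ¬q
  split (no _)  (no _)  = refl

-- Rowmotion on a finite poset: injectivity and orbit sums.

module FinitePoset {n} {_⊑_ : Rel (Fin n) 0ℓ}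
  (⊑-refl : Reflexive _⊑_) (⊑-trans : Transitive _⊑_) (⊑-antisym : Antisymmetric _≡_ _⊑_)
  (_⊑?_ : Decidable₂ _⊑_) where

  open Rowmotion ⊑-trans _⊑?_

  -- The record field is irrelevant, but membership is decidable, so a usable proof can be
  -- recomputed.
  isLowerSet : ∀ I → IsLowerSet (elements I)
  isLowerSet (mkIdeal S lower) {x} x⊑y y∈S = recompute (x ∈ˢ? S) (lower x⊑y y∈S)

  elements-injective : ∀ {I J} → elements I ≡ elements J → I ≡ J
  elements-injective refl = refl

  -- Descent along the strict order, which is well-founded on a finite set.
  minimal-below : ∀ S {x} → x ∈ˢ S → ∃ λ m → IsMinimal S m × m ⊑ x
  minimal-below S = go (po-wellFounded ⊑-isPartialOrder _)
    where
    ⊑-isPartialOrder : IsPartialOrder _≡_ _⊑_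
    ⊑-isPartialOrder = record
      { isPreorder = record
        { isEquivalence = isEquivalence ; reflexive = λ { refl → ⊑-refl } ; trans = ⊑-trans }
      ; antisym = ⊑-antisym }

    go : ∀ {x} → Acc (ToStrict._<_ _≡_ _⊑_) x → x ∈ˢ S → ∃ λ m → IsMinimal S m × m ⊑ x
    go {x} (acc rec) x∈S with any? (λ y → y ∈ˢ? S ×-dec (y ⊑? x ×-dec ¬? (y ≟ x)))
    ... | yes (y , y∈S , y⊑x , y≢x) with go (rec (y⊑x , y≢x)) y∈S
    ...   | m , min , m⊑y = m , min , ⊑-trans m⊑y y⊑x
    go {x} (acc rec) x∈S | no none =
      x , (x∈S , λ y y∈S y⊑x → decidable-stable (y ≟ x) λ y≢x → none (y , y∈S , y⊑x , y≢x)) , ⊑-refl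

  ρ-intro : ∀ I {m x} → IsMinimal (∁ (elements I)) m → x ⊑ m → x ∈ˢ elements (ρ I)
  ρ-intro I min x⊑m = ∈-comprehension⁺ (isBelow? _) (_ , ∈-comprehension⁺ (isMinimal? _) min , x⊑m)

  ρ-elim : ∀ I {x} → x ∈ˢ elements (ρ I) → ∃ λ m → IsMinimal (∁ (elements I)) m × x ⊑ m
  ρ-elim I x∈ρI with ∈-comprehension⁻ (isBelow? (minima (∁ (elements I)))) x∈ρI
  ... | m , m∈min , x⊑m = m , ∈-comprehension⁻ (isMinimal? (∁ (elements I))) m∈min , x⊑m

  -- The minimal elements of the complement form an antichain generating `ρ I`, so they are its
  -- maximal elements. Hence maximality in `ρ I` can be read off from `I`.
  maximal-ρ : ∀ I x → IsMaximal (elements (ρ I)) x ⇔ IsMinimal (∁ (elements I)) x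
  maximal-ρ I x = mk⇔ to from
    where
    to : IsMaximal (elements (ρ I)) x → IsMinimal (∁ (elements I)) x
    to (x∈ρI , max) with ρ-elim I x∈ρI
    ... | m , min , x⊑m with refl ← max m (ρ-intro I min ⊑-refl) x⊑m = min

    from : IsMinimal (∁ (elements I)) x → IsMaximal (elements (ρ I)) x
    from min@(x∉I , _) = ρ-intro I min ⊑-refl , λ y y∈ρI x⊑y →
      let m , (_ , least) , y⊑m = ρ-elim I y∈ρI
      in  ⊑-antisym (subst (y ⊑_) (sym (least x x∉I (⊑-trans x⊑y y⊑m))) y⊑m) x⊑y

  -- By `maximal-ρ`, equal images have complements with the same minimal elements. An `x` in `I` but
  -- not in `J` lies above such an element, which would then belong to `I`.
  ρ-injective : ∀ {I J} → ρ I ≡ ρ J → I ≡ J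
  ρ-injective {I} {J} eq = elements-injective (⊆-antisym (half I J eq) (half J I (sym eq)))
    where
    half : ∀ I J → ρ I ≡ ρ J → elements I ⊆ˢ elements J
    half I J eq {x} x∈I = decidable-stable (x ∈ˢ? elements J) λ x∉J →
      let m , min , m⊑x = minimal-below (∁ (elements J)) (x∉p⇒x∈∁p x∉J)
          max = subst (λ K → IsMaximal (elements K) m) (sym eq) (Equivalence.from (maximal-ρ J m) min)
          m∈∁I , _ = Equivalence.to (maximal-ρ I m) max
      in  x∈∁p⇒x∉p m∈∁I (isLowerSet I m⊑x x∈I)

  iterate-ρ-suc : ∀ I k → ρ (iterate ρ I k) ≡ iterate ρ I (suc k)
  iterate-ρ-suc I zero    = refl
  iterate-ρ-suc I (suc k) = iterate-ρ-suc (ρ I) k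

  -- `ρ` is injective and raises the exponent of an iterate by one, so it permutes the orbit.
  sumOver-ρ : ∀ {O} → IsOrbit O → ∀ f → sumOver (toList O) (f ∘ ρ) ≡ sumOver (toList O) f
  sumOver-ρ {O} (!O , I , orbit) f = sumOver-permute ρ ρ-injective !O ρO⊆O f
    where
    ρO⊆O : map ρ (toList O) ⊆ toList O
    ρO⊆O J∈ =
      let K , K∈O , J≡ρK = ∈-map⁻ ρ J∈
          k , K≡ = Equivalence.to (orbit K) K∈O
      in  Equivalence.from (orbit _) (suc k , trans J≡ρK (trans (cong ρ K≡) (iterate-ρ-suc I k)))

  χ-𝟙 : ∀ x I → χ x I ≡ 𝟙 (isMaximal? (elements I) x)
  χ-𝟙 x I = 𝟙-cong {P? = x ∈ˢ? maxima (elements I)} {isMaximal? (elements I) x}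
    (mk⇔ (∈-comprehension⁻ (isMaximal? _)) (∈-comprehension⁺ (isMaximal? _)))

  χ-ρ-𝟙 : ∀ x I → χ x (ρ I) ≡ 𝟙 (isMinimal? (∁ (elements I)) x)
  χ-ρ-𝟙 x I = trans (χ-𝟙 x (ρ I))
    (𝟙-cong {P? = isMaximal? (elements (ρ I)) x} {isMinimal? (∁ (elements I)) x} (maximal-ρ I x))

  module _ {O} (isOrbit : IsOrbit O) where
    private
      size 1/size : ℚ
      size   = sumOver (toList O) (λ _ → 1ℚ)
      1/size = 1ℤ / List⁺.length O

      size*1/size≡1 : size * 1/size ≡ 1ℚ
      size*1/size≡1 = sumOver-1-inverse (List⁺.head O) (List⁺.tail O)

    -- Multiplying by the orbit size, a sum of ones, undoes the division in `average` and makes the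
    -- hypothesis linear.
    mesic⇒sum : ∀ {f} → 0ℚ IsMesic f → sumOver (toList O) f ≡ 0ℚ
    mesic⇒sum {f} mesic = begin
      total                   ≡⟨ ℚ.*-identityʳ total ⟨
      total * 1ℚ              ≡⟨ cong (total *_) (trans (ℚ.*-comm 1/size size) size*1/size≡1) ⟨
      total * (1/size * size) ≡⟨ ℚ.*-assoc total 1/size size ⟨
      total * 1/size * size   ≡⟨ cong (_* size) (mesic O isOrbit) ⟩
      0ℚ * size               ≡⟨ ℚ.*-zeroˡ size ⟩
      0ℚ                      ∎
      where
      open ≡-Reasoning
      total : ℚ
      total = sumOver (toList O) f

    sum⇒average : ∀ {f} c → sumOver (toList O) f ≡ c * size → average f O ≡ c
    sum⇒average {f} c eq = begin
      sumOver (toList O) f * 1/size ≡⟨ cong (_* 1/size) eq ⟩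
      c * size * 1/size             ≡⟨ ℚ.*-assoc c size 1/size ⟩
      c * (size * 1/size)           ≡⟨ cong (c *_) size*1/size≡1 ⟩
      c * 1ℚ                        ≡⟨ ℚ.*-identityʳ c ⟩
      c                             ∎
      where open ≡-Reasoning

-- Partial sums of a composition.

sum-take-mono : ∀ xs {i j} → i ℕ.≤ j → sum (take i xs) ℕ.≤ sum (take j xs)
sum-take-mono xs       z≤n       = z≤n
sum-take-mono []       (s≤s _)   = z≤n
sum-take-mono (x ∷ xs) (s≤s i≤j) = ℕ.+-monoʳ-≤ x (sum-take-mono xs i≤j)

sum-take-suc : ∀ xs i → sum (take (suc (toℕ i)) xs) ≡ sum (take (toℕ i) xs) ℕ.+ lookup xs i
sum-take-suc xs i = trans (cong sum (take-suc xs i))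
  (trans (sum-++ (take (toℕ i) xs) _) (cong (sum (take (toℕ i) xs) ℕ.+_) (ℕ.+-identityʳ _)))

locate : ∀ xs {j} → j ℕ.< sum xs →
         ∃ λ (i : Fin (length xs)) → sum (take (toℕ i) xs) ℕ.≤ j × j ℕ.< sum (take (suc (toℕ i)) xs)
locate (x ∷ xs) {j} j<sum with j ℕ.<? x
... | yes j<x = zero , z≤n , ℕ.≤-trans j<x (ℕ.m≤m+n x 0)
... | no  j≮x with x+[j∸x]≡j ← ℕ.m+[n∸m]≡n (ℕ.≮⇒≥ j≮x)
      with locate xs (ℕ.+-cancelˡ-< x _ _ (subst (ℕ._< x ℕ.+ sum xs) (sym x+[j∸x]≡j) j<sum))
...   | i , lower , upper = suc i , subst (_ ℕ.≤_) x+[j∸x]≡j (ℕ.+-monoʳ-≤ x lower)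
                                  , subst (ℕ._< _) x+[j∸x]≡j (ℕ.+-monoʳ-< x upper)

-- When `i` grows by one, the part gained by the first prefix equals the mirrored part lost by the
-- second.
sum-take-palindrome : ∀ xs → (∀ i → lookup xs i ≡ lookup xs (opposite i)) →
  ∀ i → i ℕ.≤ length xs → sum (take i xs) ℕ.+ sum (take (length xs ∸ i) xs) ≡ sum xs
sum-take-palindrome xs pal zero    _   = cong sum (take-all (length xs) xs ℕ.≤-refl)
sum-take-palindrome xs pal (suc i) i<t = begin
  A (suc i) ℕ.+ A (t ∸ suc i)                    ≡⟨ cong (ℕ._+ A (t ∸ suc i)) (step k (toℕ-fromℕ< i<t)) ⟩
  A i ℕ.+ lookup xs k ℕ.+ A (t ∸ suc i)          ≡⟨ ℕ.+-assoc (A i) (lookup xs k) _ ⟩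
  A i ℕ.+ (lookup xs k ℕ.+ A (t ∸ suc i))        ≡⟨ cong (A i ℕ.+_) (ℕ.+-comm (lookup xs k) _) ⟩
  A i ℕ.+ (A (t ∸ suc i) ℕ.+ lookup xs k)        ≡⟨ cong (λ p → A i ℕ.+ (A (t ∸ suc i) ℕ.+ p)) (pal k) ⟩
  A i ℕ.+ (A (t ∸ suc i) ℕ.+ lookup xs (opposite k)) ≡⟨ cong (A i ℕ.+_) (step (opposite k) opposite-k) ⟨
  A i ℕ.+ A (suc (t ∸ suc i))                    ≡⟨ cong (λ l → A i ℕ.+ A l) (ℕ.+-∸-assoc 1 i<t) ⟨
  A i ℕ.+ A (t ∸ i)                              ≡⟨ sum-take-palindrome xs pal i (ℕ.<⇒≤ i<t) ⟩
  sum xs                                         ∎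
  where
  open ≡-Reasoning
  t = length xs
  A : ℕ → ℕ
  A l = sum (take l xs)
  k = fromℕ< i<t

  opposite-k : toℕ (opposite k) ≡ t ∸ suc i
  opposite-k = trans (opposite-prop k) (cong (λ l → t ∸ suc l) (toℕ-fromℕ< i<t))

  step : ∀ (k : Fin t) {l} → toℕ k ≡ l → A (suc l) ≡ A l ℕ.+ lookup xs k
  step k refl = sum-take-suc xs k

complement-≤ : ∀ {p q r s} → p ℕ.+ q ≡ r ℕ.+ s → p ℕ.≤ r → s ℕ.≤ q
complement-≤ {p} {q} {r} {s} eq p≤r =
  ℕ.+-cancelˡ-≤ p s q (ℕ.≤-trans (ℕ.+-monoˡ-≤ s p≤r) (ℕ.≤-reflexive (sym eq)))

odd⇒even-suc : ∀ n → 2 ∤ n → 2 ∣ suc n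
odd⇒even-suc zero          odd = contradiction (2 ∣0) odd
odd⇒even-suc (suc zero)    odd = ∣-refl
odd⇒even-suc (suc (suc n)) odd =
  ∣m∣n⇒∣m+n ∣-refl (odd⇒even-suc n λ even → odd (∣m∣n⇒∣m+n ∣-refl even))

-- Edges of the extended fence, antisymmetry and turning points.

module FenceEdges (α : FenceComposition) where
  open Fence α

  -- Edge j joins x_j to x_{j+1}, for 0 ≤ j ≤ n: the fence is extended by
  -- virtual elements x_0 and x_{n+1}.

  Up Down : ℕ → Set
  Up   j = ∃ λ i → 2 ∤ suc (toℕ i) × InSegment i j
  Down j = ∃ λ i → 2 ∣ suc (toℕ i) × InSegment i j

  up? : ∀ j → Dec (Up j)
  up? j = any? λ i → ¬? (2 ∣? suc (toℕ i)) ×-dec inSegment? i j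

  a-end : a t ≡ sum parts
  a-end = cong sum (take-all t parts ℕ.≤-refl)

  private
    sum-take-1≥1 : ∀ xs → All (1 ℕ.≤_) xs → 2 ℕ.≤ length xs → 1 ℕ.≤ sum (take 1 xs)
    sum-take-1≥1 (x ∷ xs) (p ∷ _) _ = ℕ.≤-trans p (ℕ.m≤m+n x 0)

  a-1≥1 : 1 ℕ.≤ a 1
  a-1≥1 = sum-take-1≥1 parts positive t≥2

  suc-n : suc n ≡ sum parts
  suc-n = ℕ.m+[n∸m]≡n (ℕ.≤-trans a-1≥1
    (ℕ.≤-trans (sum-take-mono parts (ℕ.<⇒≤ t≥2)) (ℕ.≤-reflexive a-end)))

  segment-unique : ∀ {i i′ j} → InSegment i j → InSegment i′ j → i ≡ i′
  segment-unique {i} {i′} p q = toℕ-injective (ℕ.≤-antisym (half i′ i q p) (half i i′ p q))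
    where
    half : ∀ i i′ {j} → InSegment i j → InSegment i′ j → toℕ i′ ℕ.≤ toℕ i
    half i i′ (_ , j<) (≤j , _) = ℕ.≮⇒≥ λ i<i′ →
      ℕ.<-irrefl refl (ℕ.<-≤-trans j< (ℕ.≤-trans (sum-take-mono parts i<i′) ≤j))

  up⊎down : ∀ j → j ℕ.≤ n → Up j ⊎ Down j
  up⊎down j j≤n with locate parts (subst (j ℕ.<_) suc-n (s≤s j≤n))
  ... | i , inSeg with 2 ∣? suc (toℕ i)
  ...   | yes even = inj₂ (i , even , inSeg)
  ...   | no  odd  = inj₁ (i , odd , inSeg)

  up⇒¬down : ∀ {j} → Up j → ¬ Down j
  up⇒¬down (i , odd , p) (i′ , even , q) with refl ← segment-unique p q = odd even

  -- Edge 0 belongs to the first, rising segment. So x_0 lies below x_1, in keeping with its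
  -- membership in every ideal.
  up-0 : Up 0
  up-0 = fromℕ< 0<t , subst (λ l → 2 ∤ suc l) (sym first) (λ { (divides (suc _) ()) })
                    , subst (λ l → a l ℕ.≤ 0 × 0 ℕ.< a (suc l)) (sym first) (z≤n , a-1≥1)
    where
    0<t : 0 ℕ.< t
    0<t = ℕ.<⇒≤ t≥2

    first : toℕ (fromℕ< 0<t) ≡ 0
    first = toℕ-fromℕ< 0<t

  ¬down-0 : ¬ Down 0
  ¬down-0 = up⇒¬down up-0

  -- Height along the fence, measured from x_0 and possibly negative. Every cover raises it by one,
  -- which excludes cycles and yields antisymmetry.
  rank : ℕ → ℤ
  rank zero    = 0ℤ
  rank (suc j) = if does (up? j) then ℤ.suc (rank j) else ℤ.pred (rank j)

  rank-up : ∀ {j} → Up j → rank (suc j) ≡ ℤ.suc (rank j)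
  rank-up {j} up with up? j
  ... | yes _  = refl
  ... | no ¬up = contradiction up ¬up

  rank-down : ∀ {j} → Down j → rank j ≡ ℤ.suc (rank (suc j))
  rank-down {j} down with up? j
  ... | yes up = contradiction down (up⇒¬down up)
  ... | no _   = sym (ℤ.suc-pred (rank j))

  ⋖⇒rank-< : ∀ {x y} → x ⋖ y → rank (index x) ℤ.< rank (index y)
  ⋖⇒rank-< {x} {y} x⋖y = ℤ.suc[i]≤j⇒i<j (ℤ.≤-reflexive (sym (rank-suc x⋖y)))
    where
    rank-suc : x ⋖ y → rank (index y) ≡ ℤ.suc (rank (index x))
    rank-suc (inj₁ (eq , up))   = trans (cong rank eq) (rank-up up)
    rank-suc (inj₂ (eq , down)) = trans (rank-down down) (cong (λ j → ℤ.suc (rank j)) (sym eq))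

  ⊑⇒≡⊎rank-< : ∀ {x y} → x ⊑ y → x ≡ y ⊎ rank (index x) ℤ.< rank (index y)
  ⊑⇒≡⊎rank-< ε = inj₁ refl
  ⊑⇒≡⊎rank-< (x⋖z ◅ z⊑y) with ⊑⇒≡⊎rank-< z⊑y
  ... | inj₁ refl = inj₂ (⋖⇒rank-< x⋖z)
  ... | inj₂ z<y  = inj₂ (ℤ.<-trans (⋖⇒rank-< x⋖z) z<y)

  ⊑-antisym : Antisymmetric _≡_ _⊑_
  ⊑-antisym x⊑y y⊑x with ⊑⇒≡⊎rank-< x⊑y | ⊑⇒≡⊎rank-< y⊑x
  ... | inj₁ x≡y | _        = x≡y
  ... | inj₂ _   | inj₁ y≡x = sym y≡x
  ... | inj₂ x<y | inj₂ y<x = contradiction y<x (ℤ.<-asym x<y)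

  ⋖-irrefl : ∀ {x} → ¬ x ⋖ x
  ⋖-irrefl x⋖x = ℤ.<-irrefl refl (⋖⇒rank-< x⋖x)

  -- Concerns x_{j+1}, the element between edges `j` and `j + 1`: it is a peak or a valley.
  Turn : ℕ → Set
  Turn j = (Up j × Down (suc j)) ⊎ (Down j × Up (suc j))

  -- All edges of a segment have one direction, so a change of direction after edge `j` ends its
  -- segment there.
  turn⇒segment-end : ∀ {j} → j ℕ.< n → Turn j → ∃ λ (i : Fin (t ∸ 1)) → a (suc (toℕ i)) ≡ suc j
  turn⇒segment-end {j} j<n turn with segments turn
    where
    segments : Turn j → ∃ λ i → InSegment i j × ¬ InSegment i (suc j)
    segments (inj₁ ((i , odd , p) , down))  = i , p , λ q → up⇒¬down (i , odd , q) down
    segments (inj₂ ((i , even , p) , up))   = i , p , λ q → up⇒¬down up (i , even , q)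
  ... | i , (a≤j , j<a) , ¬seg = fromℕ< (ℕ.∸-monoˡ-≤ {m = suc (suc (toℕ i))} 1 1+i<t)
                               , trans (cong (λ l → a (suc l)) (toℕ-fromℕ< _)) end
    where
    end : a (suc (toℕ i)) ≡ suc j
    end = ℕ.≤-antisym (ℕ.≮⇒≥ λ 1+j<a → ¬seg (ℕ.m≤n⇒m≤1+n a≤j , 1+j<a)) j<a

    -- The last segment ends at `n + 1`, beyond `j + 1`.
    1+i<t : suc (toℕ i) ℕ.< t
    1+i<t = ℕ.≤∧≢⇒< (toℕ<n i) λ 1+i≡t → ℕ.<-irrefl
      (trans (sym end) (trans (cong a 1+i≡t) (trans a-end (sym suc-n)))) (s≤s j<n)

  toℕ-s : ∀ i → toℕ (s i) ≡ a (suc (toℕ i)) ∸ 1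
  toℕ-s i = toℕ-fromℕ< _

  -- Reflection of a palindromic fence with an odd number of segments.

  module Reflected (palindromic : Palindromic) (t-odd : 2 ∤ t) where

    a-reflect : ∀ {i} → i ℕ.≤ t → a i ℕ.+ a (t ∸ i) ≡ sum parts
    a-reflect = sum-take-palindrome parts palindromic _

    suc-opposite : ∀ (i : Fin t) → suc (toℕ (opposite i)) ≡ t ∸ toℕ i
    suc-opposite i = trans (cong suc (opposite-prop i)) (sym (ℕ.+-∸-assoc 1 (toℕ<n i)))

    -- The parts total `n + 1`, while edges `j` and `j′` sum to `n`. This shift by one exchanges the
    -- weak and the strict bound of the half-open interval.
    segment-reflect : ∀ {i j j′} → j ℕ.+ j′ ≡ n → InSegment i j → InSegment (opposite i) j′
    segment-reflect {i} {j} {j′} eq (a≤j , j<a) =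
        subst (λ l → a l ℕ.≤ j′) (sym (opposite-prop i))
          (complement-≤ (trans suc-eq (sym (a-reflect (toℕ<n i)))) j<a)
      , subst (λ l → suc j′ ℕ.≤ a l) (sym (suc-opposite i))
          (complement-≤ (trans (a-reflect (ℕ.<⇒≤ (toℕ<n i)))
                               (trans (sym suc-eq) (sym (ℕ.+-suc j j′)))) a≤j)
      where
      suc-eq : suc j ℕ.+ j′ ≡ sum parts
      suc-eq = trans (cong suc eq) suc-n

    position-sum : ∀ (i : Fin t) → suc (toℕ i) ℕ.+ suc (toℕ (opposite i)) ≡ suc t
    position-sum i = cong suc (trans (cong (toℕ i ℕ.+_) (suc-opposite i))
                                     (ℕ.m+[n∸m]≡n (ℕ.<⇒≤ (toℕ<n i))))

    -- The positions of a segment and its mirror sum to `t + 1`, which is even because `t` is odd.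
    even-reflect : ∀ (i : Fin t) → 2 ∣ suc (toℕ i) → 2 ∣ suc (toℕ (opposite i))
    even-reflect i = ∣m+n∣m⇒∣n (subst (2 ∣_) (sym (position-sum i)) (odd⇒even-suc t t-odd))

    odd-reflect : ∀ (i : Fin t) → 2 ∤ suc (toℕ i) → 2 ∤ suc (toℕ (opposite i))
    odd-reflect i odd even = odd
      (subst (λ k → 2 ∣ suc (toℕ k)) (opposite-involutive i) (even-reflect (opposite i) even))

    -- Mirrored edges keep their direction when read by increasing index, so the reflection reverses
    -- the order and exchanges peaks with valleys.
    up-reflect : ∀ {j j′} → j ℕ.+ j′ ≡ n → Up j → Up j′
    up-reflect eq (i , odd , p) = opposite i , odd-reflect i odd , segment-reflect eq p

    down-reflect : ∀ {j j′} → j ℕ.+ j′ ≡ n → Down j → Down j′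
    down-reflect eq (i , even , p) = opposite i , even-reflect i even , segment-reflect eq p

    ¬down-n : ¬ Down n
    ¬down-n down = ¬down-0 (down-reflect (ℕ.+-identityʳ n) down)

    s-opposite : ∀ i → s (opposite i) ≡ opposite (s i)
    s-opposite i = toℕ-injective (begin
      toℕ (s (opposite i))                 ≡⟨ toℕ-s (opposite i) ⟩
      a (suc (toℕ (opposite i))) ∸ 1       ≡⟨ cong (λ l → a l ∸ 1) position ⟩
      a (t ∸ suc (toℕ i)) ∸ 1              ≡⟨ cong (_∸ 1) (ℕ.m+n∸m≡n (a (suc (toℕ i))) _) ⟨
      a (suc (toℕ i)) ℕ.+ a (t ∸ suc (toℕ i)) ∸ a (suc (toℕ i)) ∸ 1
                                           ≡⟨ cong (λ l → l ∸ a (suc (toℕ i)) ∸ 1) (a-reflect (ℕ.<⇒≤ 1+i<t)) ⟩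
      sum parts ∸ a (suc (toℕ i)) ∸ 1      ≡⟨ cong (λ l → sum parts ∸ l ∸ 1) suc-s ⟨
      sum parts ∸ suc (toℕ (s i)) ∸ 1      ≡⟨ ∸-comm (sum parts) (suc (toℕ (s i))) 1 ⟩
      n ∸ suc (toℕ (s i))                  ≡⟨ opposite-prop (s i) ⟨
      toℕ (opposite (s i))                 ∎)
      where
      open ≡-Reasoning

      ∸-comm : ∀ p q r → p ∸ q ∸ r ≡ p ∸ r ∸ q
      ∸-comm p q r = trans (ℕ.∸-+-assoc p q r)
        (trans (cong (p ∸_) (ℕ.+-comm q r)) (sym (ℕ.∸-+-assoc p r q)))

      1+i<t : suc (toℕ i) ℕ.< t
      1+i<t = ℕ.≤-trans (s≤s (toℕ<n i)) (ℕ.≤-reflexive (ℕ.m+[n∸m]≡n (ℕ.<⇒≤ t≥2)))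

      position : suc (toℕ (opposite i)) ≡ t ∸ suc (toℕ i)
      position = begin
        suc (toℕ (opposite i))       ≡⟨ cong suc (opposite-prop i) ⟩
        suc (t ∸ 1 ∸ suc (toℕ i))    ≡⟨ ℕ.+-∸-assoc 1 (toℕ<n i) ⟨
        suc (t ∸ 1) ∸ suc (toℕ i)    ≡⟨ cong (_∸ suc (toℕ i)) (ℕ.m+[n∸m]≡n (ℕ.<⇒≤ t≥2)) ⟩
        t ∸ suc (toℕ i)              ∎

      suc-s : suc (toℕ (s i)) ≡ a (suc (toℕ i))
      suc-s = trans (cong suc (toℕ-s i)) (ℕ.m+[n∸m]≡n (ℕ.≤-trans a-1≥1 (sum-take-mono parts (s≤s z≤n))))

-- Membership and maximality read off from neighbours.

module FenceIdeals (α : FenceComposition) (¬down-end : ¬ FenceEdges.Down α (Fence.n α)) where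
  open Fence α
  open FenceEdges α
  open FinitePoset ε _◅◅_ ⊑-antisym _⊑?_ using (isLowerSet; χ-𝟙; χ-ρ-𝟙)

  -- Stated on indices so that it also covers x_0 and x_{n+1}. On actual elements it unfolds to
  -- `_⋖_`.
  Cover : ℕ → ℕ → Set
  Cover u v = (v ≡ suc u × Up u) ⊎ (u ≡ suc v × Down v)

  Member : ℕ → OrderIdeal → Set
  Member j I = j ≡ 0 ⊎ ∃ λ x → index x ≡ j × x ∈ˢ elements I

  member? : ∀ j I → Dec (Member j I)
  member? j I = j ℕ.≟ 0 ⊎-dec any? λ x → index x ℕ.≟ j ×-dec x ∈ˢ? elements I

  member⇒∈ : ∀ {x} I → Member (index x) I → x ∈ˢ elements I
  member⇒∈ I (inj₂ (y , eq , y∈I)) =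
    subst (_∈ˢ elements I) (toℕ-injective (ℕ.suc-injective eq)) y∈I

  ¬member-end : ∀ I → ¬ Member (suc n) I
  ¬member-end I (inj₂ (x , eq , _)) = ℕ.<-irrefl (ℕ.suc-injective eq) (toℕ<n x)

  ¬cover-0 : ∀ {u} → ¬ Cover u 0
  ¬cover-0 (inj₂ (_ , down)) = ¬down-0 down

  element : ∀ {j} → j ℕ.< n → ∃ λ x → index x ≡ suc j
  element j<n = fromℕ< j<n , cong suc (toℕ-fromℕ< j<n)

  lower-element : ∀ {u} y → Cover u (index y) → u ≡ 0 ⊎ ∃ λ x → index x ≡ u
  lower-element {zero}  y _               = inj₁ refl
  lower-element {suc u} y (inj₁ (eq , _)) =
    inj₂ (element (ℕ.<⇒≤ (subst (ℕ._< n) (ℕ.suc-injective eq) (toℕ<n y))))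
  lower-element {suc u} y (inj₂ (refl , down)) =
    -- The lower neighbour could be x_{n+1} only if edge `n` descended.
    inj₂ (element (ℕ.≤∧≢⇒< (toℕ<n y) λ eq → ¬down-end (subst Down eq down)))

  cover-member : ∀ {u v} I → Cover u v → Member v I → Member u I
  cover-member I c (inj₁ refl) = contradiction c ¬cover-0
  cover-member I c (inj₂ (y , refl , y∈I)) with lower-element y c
  ... | inj₁ u≡0        = inj₁ u≡0
  ... | inj₂ (x , refl) = inj₂ (x , refl , isLowerSet I (c ◅ ε) y∈I)

  -- An ideal is closed downwards, so any member strictly above `x` brings with it the first cover
  -- on a chain from `x`.
  maximal-covers : ∀ x I → IsMaximal (elements I) x ⇔
    (Member (index x) I × (∀ v → Cover (index x) v → ¬ Member v I))
  maximal-covers x I = mk⇔ to from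
    where
    to : IsMaximal (elements I) x → Member (index x) I × (∀ v → Cover (index x) v → ¬ Member v I)
    to (x∈I , max) = inj₂ (x , refl , x∈I) , λ
      { v c (inj₁ refl)             → ¬cover-0 c
      ; v c (inj₂ (y , refl , y∈I)) → ⋖-irrefl (subst (x ⋖_) (max y y∈I (c ◅ ε)) c) }

    from : Member (index x) I × (∀ v → Cover (index x) v → ¬ Member v I) → IsMaximal (elements I) x
    from (x∈I , ∉I) = member⇒∈ I x∈I , λ
      { y y∈I ε           → refl
      ; y y∈I (c ◅ z⊑y) → contradiction (inj₂ (_ , refl , isLowerSet I z⊑y y∈I)) (∉I _ c) }

  minimal-covers : ∀ x I → IsMinimal (∁ (elements I)) x ⇔
    ((∀ u → Cover u (index x) → Member u I) × ¬ Member (index x) I)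
  minimal-covers x I = mk⇔ to from
    where
    to : IsMinimal (∁ (elements I)) x → (∀ u → Cover u (index x) → Member u I) × ¬ Member (index x) I
    to (x∉I , min) = below , x∈∁p⇒x∉p x∉I ∘ member⇒∈ I
      where
      below : ∀ u → Cover u (index x) → Member u I
      below u c with lower-element x c
      ... | inj₁ u≡0        = inj₁ u≡0
      ... | inj₂ (y , refl) = decidable-stable (member? (index y) I) λ ∉I →
        ⋖-irrefl (subst (_⋖ x) (min y (x∉p⇒x∈∁p λ y∈I → ∉I (inj₂ (y , refl , y∈I))) (c ◅ ε)) c)

    -- Chains are built from their lower end, whereas minimality needs the final cover below `x`.
    last-step : ∀ {y} → y ⊑ x → y ≡ x ⊎ ∃ λ z → y ⊑ z × z ⋖ x
    last-step ε = inj₁ refl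
    last-step {y} (c ◅ rest) with last-step rest
    ... | inj₁ refl            = inj₂ (y , ε , c)
    ... | inj₂ (z , z′⊑z , z⋖x) = inj₂ (z , c ◅ z′⊑z , z⋖x)

    from : (∀ u → Cover u (index x) → Member u I) × ¬ Member (index x) I → IsMinimal (∁ (elements I)) x
    from (below , x∉I) = x∉p⇒x∈∁p (λ x∈I → x∉I (inj₂ (x , refl , x∈I))) , least
      where
      least : ∀ y → y ∈ˢ ∁ (elements I) → y ⊑ x → y ≡ x
      least y y∉I y⊑x with last-step y⊑x
      ... | inj₁ y≡x             = y≡x
      ... | inj₂ (z , y⊑z , z⋖x) =
        contradiction (isLowerSet I y⊑z (member⇒∈ I (below _ z⋖x))) (x∈∁p⇒x∉p y∉I)

  H : ℕ → OrderIdeal → ℚ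
  H j I = 𝟙 (member? j I)

  H-index : ∀ x I → H (index x) I ≡ χ̂ x I
  H-index x I = 𝟙-cong {P? = member? (index x) I} {x ∈ˢ? elements I}
    (mk⇔ (member⇒∈ I) λ x∈I → inj₂ (x , refl , x∈I))

  H-end : ∀ I → H (suc n) I ≡ 0ℚ
  H-end I = cong (if_then 1ℚ else 0ℚ) (dec-false (member? (suc n) I) (¬member-end I))

  -- A peak has no upper cover and a valley no lower cover: there x_{n+1}, in no
  -- ideal, and x_0, in every ideal, serve instead.
  SoleUpper SoleLower : ℕ → ℕ → Set
  SoleUpper j v = (∀ {w} → Cover j w → w ≡ v) × (Cover j v ⊎ v ≡ suc n)
  SoleLower j u = (∀ {w} → Cover w j → w ≡ u) × (Cover u j ⊎ u ≡ 0)

  -- `x` is maximal exactly when it is in `I` and `v` is not. At a peak, `v` is the virtual element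
  -- in no ideal.
  χ-upper : ∀ {x v} → SoleUpper (index x) v → ∀ I → χ x I ≡ H (index x) I - H v I
  χ-upper {x} {v} (sole , covers) I = trans (χ-𝟙 x I)
    (𝟙-diff (isMaximal? (elements I) x) (member? (index x) I) (member? v I) (mk⇔ to from) below)
    where
    below : Member v I → Member (index x) I
    below v∈I = [ (λ c → cover-member I c v∈I)
                , (λ v≡ → contradiction (subst (λ j → Member j I) v≡ v∈I) (¬member-end I)) ]′ covers

    to : IsMaximal (elements I) x → Member (index x) I × ¬ Member v I
    to max = let x∈I , ∉I = Equivalence.to (maximal-covers x I) max in
      x∈I , [ ∉I v , (λ v≡ → ¬member-end I ∘ subst (λ j → Member j I) v≡) ]′ covers

    from : Member (index x) I × ¬ Member v I → IsMaximal (elements I) x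
    from (x∈I , v∉I) = Equivalence.from (maximal-covers x I)
      (x∈I , λ w c → v∉I ∘ subst (λ j → Member j I) (sole c))

  -- The dual count: `x` is minimal outside `I` exactly when `u` is in `I` and `x` is not.
  χ-ρ-lower : ∀ {x u} → SoleLower (index x) u → ∀ I → χ x (ρ I) ≡ H u I - H (index x) I
  χ-ρ-lower {x} {u} (sole , covers) I = trans (χ-ρ-𝟙 x I)
    (𝟙-diff (isMinimal? (∁ (elements I)) x) (member? u I) (member? (index x) I) (mk⇔ to from) below)
    where
    below : Member (index x) I → Member u I
    below x∈I = [ (λ c → cover-member I c x∈I) , inj₁ ]′ covers

    to : IsMinimal (∁ (elements I)) x → Member u I × ¬ Member (index x) I
    to min = let ∈I , x∉I = Equivalence.to (minimal-covers x I) min in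
      [ ∈I u , inj₁ ]′ covers , x∉I

    from : Member u I × ¬ Member (index x) I → IsMinimal (∁ (elements I)) x
    from (u∈I , x∉I) = Equivalence.from (minimal-covers x I)
      ((λ w c → subst (λ j → Member j I) (sym (sole c)) u∈I) , x∉I)

  -- Inside a segment there is one neighbour above and one below, so both counts of maximal
  -- occurrences apply.
  up-up : ∀ {p} → Up p → Up (suc p) → SoleUpper (suc p) (suc (suc p)) × SoleLower (suc p) p
  up-up up up′ =
      ((λ { (inj₁ (eq , _))      → eq
          ; (inj₂ (refl , down)) → contradiction down (up⇒¬down up) }) , inj₁ (inj₁ (refl , up′)))
    , ((λ { (inj₁ (refl , _))    → refl
          ; (inj₂ (_ , down))    → contradiction down (up⇒¬down up′) }) , inj₁ (inj₁ (refl , up)))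

  down-down : ∀ {p} → Down p → Down (suc p) → SoleUpper (suc p) p × SoleLower (suc p) (suc (suc p))
  down-down down down′ =
      ((λ { (inj₁ (_ , up))    → contradiction down′ (up⇒¬down up)
          ; (inj₂ (refl , _))  → refl }) , inj₁ (inj₂ (refl , down)))
    , ((λ { (inj₁ (refl , up)) → contradiction down (up⇒¬down up)
          ; (inj₂ (eq , _))    → eq }) , inj₁ (inj₂ (refl , down′)))

  peak : ∀ {p} → Up p → Down (suc p) → SoleUpper (suc p) (suc n)
  peak up down = (λ { (inj₁ (_ , up′))      → contradiction down (up⇒¬down up′)
                    ; (inj₂ (refl , down′)) → contradiction down′ (up⇒¬down up) }) , inj₂ refl

  valley : ∀ {p} → Down p → Up (suc p) → SoleLower (suc p) 0
  valley down up = (λ { (inj₁ (refl , up′)) → contradiction down (up⇒¬down up′)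
                      ; (inj₂ (_ , down′))  → contradiction down′ (up⇒¬down up) }) , inj₂ refl

-- Linear identities for mirrored counts.

-- Adds the harmonic relations at an element and at its mirror. Since reflection reverses the order,
-- `a` is paired with `c′` and `c` with `a′`.
harmonic-pair : ∀ a b c a′ b′ c′ → b - c ≡ a - b → b′ - c′ ≡ a′ - b′ →
                (a + c′) + (c + a′) ≡ (b + b′) + (b + b′)
harmonic-pair a b c a′ b′ c′ eq eq′ = begin
  (a + c′) + (c + a′)                                ≡⟨ split a b c a′ b′ c′ ⟩
  ((a - b) + (b + c)) + ((a′ - b′) + (b′ + c′))      
    ≡⟨ cong₂ (λ d d′ → (d + (b + c)) + (d′ + (b′ + c′))) eq eq′ ⟨
  ((b - c) + (b + c)) + ((b′ - c′) + (b′ + c′))      ≡⟨ join b c b′ c′ ⟩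
  (b + b′) + (b + b′)                                ∎
  where
  open ≡-Reasoning
  split = solve 6 (λ a b c a′ b′ c′ → (a :+ c′) :+ (c :+ a′) :=
    ((a :- b) :+ (b :+ c)) :+ ((a′ :- b′) :+ (b′ :+ c′))) refl
  join = solve 4 (λ b c b′ c′ → ((b :- c) :+ (b :+ c)) :+ ((b′ :- c′) :+ (b′ :+ c′)) :=
    (b :+ b′) :+ (b :+ b′)) refl

-⇒+ : ∀ a b c d → a - c ≡ d - b → a + b ≡ d + c
-⇒+ a b c d eq = begin
  a + b                 ≡⟨ solve 3 (λ a b c → a :+ b := (a :- c) :+ (b :+ c)) refl a b c ⟩
  (a - c) + (b + c)     ≡⟨ cong (_+ (b + c)) eq ⟩
  (d - b) + (b + c)     ≡⟨ solve 3 (λ b c d → (d :- b) :+ (b :+ c) := d :+ c) refl b c d ⟩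
  d + c                 ∎
  where open ≡-Reasoning

+⇒- : ∀ a b c d → a + b ≡ c + d → a - c ≡ d - b
+⇒- a b c d eq = begin
  a - c                 ≡⟨ solve 3 (λ a b c → a :- c := (a :+ b) :- (b :+ c)) refl a b c ⟩
  (a + b) - (b + c)     ≡⟨ cong (_- (b + c)) eq ⟩
  (c + d) - (b + c)     ≡⟨ solve 3 (λ b c d → (c :+ d) :- (b :+ c) := d :- b) refl b c d ⟩
  d - b                 ∎
  where open ≡-Reasoning

-- The reflection argument.

module PalindromicFence (α : FenceComposition)
  (palindromic : Fence.Palindromic α) (t-odd : 2 ∤ Fence.t α) where
  open Fence α
  open FenceEdges α
  open Reflected palindromic t-odd
  open FenceIdeals α ¬down-n
  open FinitePoset ε _◅◅_ ⊑-antisym _⊑?_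

  module Reflection (h : ℕ → ℚ) (r : Fin n → ℚ)
    (r-upper : ∀ {x v} → SoleUpper (index x) v → r x ≡ h (index x) - h v)
    (r-lower : ∀ {x u} → SoleLower (index x) u → r x ≡ h u - h (index x))
    (r-turn : ∀ x → Turn (toℕ x) → r x ≡ r (opposite x)) where

    g : ℕ → ℚ
    g j = h j + h (suc n ∸ j)

    -- For orbit counts this is the orbit size, as x_0 is in every ideal and x_{n+1} in none.
    c : ℚ
    c = h 0 + h (suc n)

    index-opposite : ∀ x → n ∸ toℕ x ≡ index (opposite x)
    index-opposite x = trans (ℕ.+-∸-assoc 1 (toℕ<n x)) (cong suc (sym (opposite-prop x)))

    -- The edges beside `x` are `toℕ x` and `index x`. Reflection takes them to those beside
    -- `opposite x` in exchanged order.
    mirror : ∀ x → toℕ x ℕ.+ index (opposite x) ≡ n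
    mirror x = trans (cong (toℕ x ℕ.+_) (sym (index-opposite x))) (ℕ.m+[n∸m]≡n (ℕ.<⇒≤ (toℕ<n x)))

    mirror′ : ∀ x → index x ℕ.+ toℕ (opposite x) ≡ n
    mirror′ x = trans (sym (ℕ.+-suc (toℕ x) _)) (mirror x)

    g-here : ∀ x → g (index x) ≡ h (index x) + h (index (opposite x))
    g-here x = cong (λ j → h (index x) + h j) (index-opposite x)

    g-before : ∀ x → g (toℕ x) ≡ h (toℕ x) + h (suc (index (opposite x)))
    g-before x = cong (λ j → h (toℕ x) + h j)
      (trans (ℕ.+-∸-assoc 1 (ℕ.<⇒≤ (toℕ<n x))) (cong suc (index-opposite x)))

    g-after : ∀ x → g (suc (index x)) ≡ h (suc (index x)) + h (toℕ (opposite x))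
    g-after x = cong (λ j → h (suc (index x)) + h j) (sym (opposite-prop x))

    -- v and u are the neighbours of x above and below it, v′ and u′ those of its
    -- reflection.
    Straight : Fin n → (u v u′ v′ : ℕ) → Set
    Straight x u v u′ v′ =
      (r x ≡ h (index x) - h v × r x ≡ h u - h (index x)) ×
      (r (opposite x) ≡ h (index (opposite x)) - h v′ × r (opposite x) ≡ h u′ - h (index (opposite x)))

    straight : ∀ {x u v u′ v′} →
      SoleUpper (index x) v × SoleLower (index x) u →
      SoleUpper (index (opposite x)) v′ × SoleLower (index (opposite x)) u′ →
      Straight x u v u′ v′
    straight (up , low) (up′ , low′) = (r-upper up , r-lower low) , (r-upper up′ , r-lower low′)

    straight-harmonic : ∀ {x u v u′ v′} → Straight x u v u′ v′ →
      (h u + h v′) + (h v + h u′) ≡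
      (h (index x) + h (index (opposite x))) + (h (index x) + h (index (opposite x)))
    straight-harmonic {x} {u} {v} {u′} {v′} ((eq₁ , eq₂) , (eq₁′ , eq₂′)) =
      harmonic-pair (h u) (h (index x)) (h v) (h u′) (h (index (opposite x))) (h v′)
        (trans (sym eq₁) eq₂) (trans (sym eq₁′) eq₂′)

    -- One case analysis serves both claims: turns get their values from the hypothesis, other
    -- elements from the two counts at `x` and at its mirror.
    data Shape (x : Fin n) : Set where
      turning : r x ≡ r (opposite x) → g (index x) ≡ c → Shape x
      rising  : Straight x (toℕ x) (suc (index x))
                           (toℕ (opposite x)) (suc (index (opposite x))) → Shape x
      falling : Straight x (suc (index x)) (toℕ x)
                           (suc (index (opposite x))) (toℕ (opposite x)) → Shape x

    shape : ∀ x → Shape x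
    shape x with up⊎down (toℕ x) (ℕ.<⇒≤ (toℕ<n x)) | up⊎down (index x) (toℕ<n x)
    ... | inj₁ up | inj₁ up′ = rising (straight (up-up up up′)
      (up-up (up-reflect (mirror′ x) up′) (up-reflect (mirror x) up)))
    ... | inj₂ down | inj₂ down′ = falling (straight (down-down down down′)
      (down-down (down-reflect (mirror′ x) down′) (down-reflect (mirror x) down)))
    -- The mirror of this peak is a valley; equating the count from above at `x` with the count from
    -- below at the mirror gives `c`.
    ... | inj₁ up | inj₂ down = turning r≡r′ (trans (g-here x)
      (-⇒+ (h (index x)) (h (index (opposite x))) (h (suc n)) (h 0)
        (trans (sym (r-upper (peak up down))) (trans r≡r′ (r-lower (valley
          (down-reflect (mirror′ x) down) (up-reflect (mirror x) up)))))))
      where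
      r≡r′ : r x ≡ r (opposite x)
      r≡r′ = r-turn x (inj₁ (up , down))
    ... | inj₂ down | inj₁ up = turning r≡r′ (trans (g-here x) (trans (ℚ.+-comm (h (index x)) _)
      (-⇒+ (h (index (opposite x))) (h (index x)) (h (suc n)) (h 0)
        (trans (sym (r-upper (peak (up-reflect (mirror′ x) up)
          (down-reflect (mirror x) down)))) (trans (sym r≡r′) (r-lower (valley down up)))))))
      where
      r≡r′ : r x ≡ r (opposite x)
      r≡r′ = r-turn x (inj₂ (down , up))

    g≡c⊎harmonic : ∀ x → g (index x) ≡ c ⊎ g (toℕ x) + g (suc (index x)) ≡ g (index x) + g (index x)
    g≡c⊎harmonic x with shape x
    ... | turning _ eq = inj₁ eq
    ... | rising str   = inj₂ (trans (cong₂ _+_ (g-before x) (g-after x))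
      (trans (straight-harmonic str) (sym (cong₂ _+_ (g-here x) (g-here x)))))
    ... | falling str  = inj₂ (trans (ℚ.+-comm (g (toℕ x)) _) (trans
      (cong₂ _+_ (g-after x) (g-before x)) (trans (straight-harmonic str) (sym (cong₂ _+_ (g-here x) (g-here x))))))

    g≡c : ∀ j → j ℕ.≤ suc n → g j ≡ c
    g≡c = maximum-principle g c refl
      (trans (cong (λ j → h (suc n) + h j) (ℕ.n∸n≡0 n)) (ℚ.+-comm (h (suc n)) (h 0)))
      λ { j (s≤s j<n) → subst
            (λ j → g (suc j) ≡ c ⊎ g j + g (suc (suc j)) ≡ g (suc j) + g (suc j))
            (toℕ-fromℕ< j<n) (g≡c⊎harmonic (fromℕ< j<n)) }

    h-reflect : ∀ x → h (index x) + h (index (opposite x)) ≡ c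
    h-reflect x = trans (sym (g-here x)) (g≡c (index x) (s≤s (ℕ.<⇒≤ (toℕ<n x))))

    -- Away from turns, `r x` is taken from above and `r (opposite x)` from below. The neighbours
    -- used are mirror images, so both pairs of `h` values sum to `c`.
    r-reflect : ∀ x → r x ≡ r (opposite x)
    r-reflect x with shape x
    ... | turning eq _ = eq
    ... | rising ((eq , _) , (_ , eq′)) = trans eq (trans
      (+⇒- (h (index x)) (h (index (opposite x))) (h (suc (index x))) (h (toℕ (opposite x)))
        (trans (h-reflect x) (trans (sym (g≡c (suc (index x)) (s≤s (toℕ<n x)))) (g-after x))))
      (sym eq′))
    ... | falling ((eq , _) , (_ , eq′)) = trans eq (trans
      (+⇒- (h (index x)) (h (index (opposite x))) (h (toℕ x)) (h (suc (index (opposite x))))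
        (trans (h-reflect x) (trans (sym (g≡c (toℕ x) (ℕ.m≤n⇒m≤1+n (ℕ.<⇒≤ (toℕ<n x))))) (g-before x))))
      (sym eq′))

  -- Orbit counts and the two averages.

  module OnOrbit {O} (isOrbit : IsOrbit O)
    (shared : ∀ i → 0ℚ IsMesic (λ I → χ (s i) I - χ (s (opposite i)) I)) where

    h : ℕ → ℚ
    h j = sumOver (toList O) (H j)

    r : Fin n → ℚ
    r x = sumOver (toList O) (χ x)

    r-upper : ∀ {x v} → SoleUpper (index x) v → r x ≡ h (index x) - h v
    r-upper {x} {v} sole = trans (sumOver-cong (toList O) (χ-upper sole))
      (sumOver-- (toList O) (H (index x)) (H v))

    r-lower : ∀ {x u} → SoleLower (index x) u → r x ≡ h u - h (index x)
    -- Summing over `ρ I` instead of `I` leaves the total unchanged and gives access to the count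
    -- from below.
    r-lower {x} {u} sole = trans (sym (sumOver-ρ isOrbit (χ x)))
      (trans (sumOver-cong (toList O) (χ-ρ-lower sole)) (sumOver-- (toList O) (H u) (H (index x))))

    r-shared : ∀ i → r (s i) ≡ r (opposite (s i))
    r-shared i = trans
      (x∙y⁻¹≈ε⇒x≈y (r (s i)) (r s′) (trans (sym (sumOver-- (toList O) (χ (s i)) (χ s′)))
        (mesic⇒sum isOrbit {f = λ I → χ (s i) I - χ s′ I} (shared i))))
      (cong r (s-opposite i))
      where
      s′ : Fin n
      s′ = s (opposite i)

    -- Every peak or valley is a shared element, so the hypothesis reaches all turns.
    r-turn : ∀ x → Turn (toℕ x) → r x ≡ r (opposite x)
    r-turn x turn =
      let i , end = turn⇒segment-end (toℕ<n x) turn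
          x≡s = toℕ-injective (trans (cong (_∸ 1) (sym end)) (sym (toℕ-s i)))
      in  subst (λ y → r y ≡ r (opposite y)) (sym x≡s) (r-shared i)

    open Reflection h r r-upper r-lower r-turn using (h-reflect; r-reflect)

    χ-average : ∀ x → average (λ I → χ x I - χ (opposite x) I) O ≡ 0ℚ
    χ-average x = sum⇒average isOrbit {f = λ I → χ x I - χ (opposite x) I} 0ℚ (begin
      sumOver (toList O) (λ I → χ x I - χ (opposite x) I) ≡⟨ sumOver-- (toList O) (χ x) (χ (opposite x)) ⟩
      r x - r (opposite x)                                ≡⟨ cong (_- r (opposite x)) (r-reflect x) ⟩
      r (opposite x) - r (opposite x)                     ≡⟨ ℚ.+-inverseʳ (r (opposite x)) ⟩
      0ℚ                                                  ≡⟨ ℚ.*-zeroˡ (sumOver (toList O) (λ _ → 1ℚ)) ⟨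
      0ℚ * sumOver (toList O) (λ _ → 1ℚ)                  ∎)
      where open ≡-Reasoning

    χ̂-average : ∀ x → average (λ I → χ̂ x I + χ̂ (opposite x) I) O ≡ 1ℚ
    χ̂-average x = sum⇒average isOrbit {f = λ I → χ̂ x I + χ̂ (opposite x) I} 1ℚ (begin
      sumOver (toList O) (λ I → χ̂ x I + χ̂ (opposite x) I)
        ≡⟨ sumOver-cong (toList O) (λ I → cong₂ _+_ (H-index x I) (H-index (opposite x) I)) ⟨
      sumOver (toList O) (λ I → H (index x) I + H (index (opposite x)) I)
        ≡⟨ sumOver-+ (toList O) (H (index x)) (H (index (opposite x))) ⟩
      h (index x) + h (index (opposite x))
        ≡⟨ h-reflect x ⟩
      h 0 + h (suc n)
        ≡⟨ sumOver-+ (toList O) (H 0) (H (suc n)) ⟨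
      sumOver (toList O) (λ I → H 0 I + H (suc n) I)
        -- `H 0` computes to 1 and `H (suc n)` vanishes.
        ≡⟨ sumOver-cong (toList O) (λ I → cong (1ℚ +_) (H-end I)) ⟩
      sumOver (toList O) (λ _ → 1ℚ)
        ≡⟨ ℚ.*-identityˡ (sumOver (toList O) (λ _ → 1ℚ)) ⟨
      1ℚ * sumOver (toList O) (λ _ → 1ℚ) ∎)
      where open ≡-Reasoning

theorem5p9 : (α : FenceComposition) → let open Fence α in
    Palindromic → 2 ∤ t →
    (∀ i → 0ℚ IsMesic (λ I → χ (s i) I - χ (s (opposite i)) I)) →
    (∀ k → 0ℚ IsMesic (λ I → χ k I - χ (opposite k) I)) ×
    (∀ k → 1ℚ IsMesic (λ I → χ̂ k I + χ̂ (opposite k) I))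
theorem5p9 α palindromic t-odd shared =
    (λ k O isOrbit → OnOrbit.χ-average isOrbit shared k)
  , (λ k O isOrbit → OnOrbit.χ̂-average isOrbit shared k)
  where open PalindromicFence α palindromic t-odd
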